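{- Let $R$ be a proof-structure. The following are equivalent: (i) $R$ is a $(\neg\mathsf w\otimes)$-proof-structure; (ii) $R\models\mathsf C_{\mathsf w}^{\forall}$, i.e. for every $\mathsf w$-compatible switching $\psi$ of $R$ we have $R^\psi\models\mathsf C_{\mathsf w}^{\forall}$; (iii) there exists a $\mathsf w$-compatible switching $\psi$ of $R$ such that $R^\psi\models\mathsf C_{\mathsf w}^{\forall}$.
   Context: Graphs are finite directed graphs (parallel arcs allowed, no loops). An arc is a conclusion of its tail and a premise of its head. $\wp$ denotes the "par" connective. A linear logical graph is such a graph without directed cycles, each node labelled by one of $\mathtt{ax},\mathtt{cut},\mathtt 1,\bot,\otimes,\wp,\bullet$, where: an $\mathtt{ax}$ node has exactly 2 conclusions and no premise; a $\mathtt{cut}$ node exactly 2 premises and no conclusion; a $\mathtt 1$ or $\bot$ node exactly 1 conclusion and no premise; a $\otimes$ node exactly 2 premises and 1 conclusion; a $\wp$ node 1 or 2 premises and 1 conclusion; a $\bullet$ node exactly 1 premise and no conclusion. A proof-structure (ps) is a linear logical graph in which every $\wp$ node has two premises, with an ordering of the premises of each $\otimes$ and $\wp$ node and a total ordering of the premises of its $\bullet$ nodes (the conclusions of the ps). A switching $\varphi$ of a ps $R$ maps each $\wp$ node to one of its premises. The switching graph $R^\varphi$ is obtained by adding, for each $\wp$ node $n$, a fresh $\bullet$ node and redirecting to it the head of the premise of $n$ different from $\varphi(n)$. Erasing nodes (inductive definition): a node is erasing when it is a $\bot$, $\wp$ or $\bullet$ node all of whose premises are conclusions of erasing nodes (in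 particular every $\bot$ node is erasing). A $(\neg\mathsf w\otimes)$-proof-structure is a ps in which no premise of a $\mathtt{cut}$ or $\otimes$ node is the conclusion of an erasing node. A switching $\psi$ of $R$ is $\mathsf w$-compatible if for every $\wp$ node $n$ of $R$ such that exactly one of its premises, say $a$, is not the conclusion of an erasing node, $\psi(n)=a$. A thread is a (connected) linear logical graph with exactly one $\bot$ node and in which every other node has exactly one premise. For a switching $\varphi$ of $R$, $R^\varphi\models\mathsf C_{\mathsf w}^{\forall}$ means that every connected component of $R^\varphi$ either contains no node that is an erasing node of $R$, or is a thread. -}

module Defs where

open import Data.Fin.Base using (Fin)
open import Data.Fin.Properties using (inj⇒≟)
open import Data.Irrelevant as Irrelevant using ()
open import Data.Nat.Base using (ℕ)
open import Data.Product using (∃; ∃!; _×_; _,_; proj₁; proj₂)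
open import Data.Refinement.Base using (Refinement-syntax; value; _,_)
open import Data.Sum.Base using (_⊎_; inj₁; inj₂; [_,_]′)
open import Function.Base using (const)
open import Function.Bundles using (_↔_)
open import Function.Properties.Inverse using (↔⇒↣)
open import Level using (0ℓ)
open import Relation.Binary.Construct.Closure.Equivalence using (EqClosure)
open import Relation.Binary.Construct.Closure.Transitive using (TransClosure)
open import Relation.Binary.Core using (Rel)
open import Relation.Binary.Definitions using (DecidableEquality)
open import Relation.Binary.PropositionalEquality.Core using (_≡_; _≢_; refl)
open import Relation.Binary.Structures using (IsTotalOrder)
open import Relation.Nullary.Decidable.Core using (Dec; yes; no)
open import Relation.Nullary.Negation.Core using (¬_)
open import Relation.Unary using (Pred)

infix 4 _HasSize_

_HasSize_ : Set → ℕ → Set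
A HasSize k = A ↔ Fin k

Finite : Set → Set
Finite A = ∃ λ k → A HasSize k

TotalOrdering : Set → Set₁
TotalOrdering A = ∃ λ (_≼_ : Rel A 0ℓ) → IsTotalOrder _≡_ _≼_

------------------------------------------------------------------------
-- Linear logical graphs

data Label : Set where
  ax cut 𝟙 bot ⊗ ⅋ ● : Label

isPar? : (l : Label) → Dec (l ≡ ⅋)
isPar? ⅋   = yes refl
isPar? ax  = no λ ()
isPar? cut = no λ ()
isPar? 𝟙   = no λ ()
isPar? bot = no λ ()
isPar? ⊗   = no λ ()
isPar? ●   = no λ ()

-- Finiteness and the absence of loops are required in IsLinearLogical.

record Graph : Set₁ where
  field
    Node  : Set
    Arc   : Set
    tail  : Arc → Node
    head  : Arc → Node
    label : Node → Label

  Premise : Node → Set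
  Premise n = ∃ λ a → head a ≡ n

  Conclusion : Node → Set
  Conclusion n = ∃ λ a → tail a ≡ n

  Edge : Rel Node 0ℓ
  Edge x y = ∃ λ a → tail a ≡ x × head a ≡ y

  Linked : Rel Node 0ℓ
  Linked = EqClosure Edge

Arity : Label → (Premises Conclusions : Set) → Set
Arity ax  P C = P HasSize 0 × C HasSize 2
Arity cut P C = P HasSize 2 × C HasSize 0
Arity 𝟙   P C = P HasSize 0 × C HasSize 1
Arity bot P C = P HasSize 0 × C HasSize 1
Arity ⊗   P C = P HasSize 2 × C HasSize 1
Arity ⅋   P C = (P HasSize 1 ⊎ P HasSize 2) × C HasSize 1
Arity ●   P C = P HasSize 1 × C HasSize 0

record IsLinearLogical (G : Graph) : Set where
  open Graph G
  field
    finiteNodes : Finite Node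
    finiteArcs  : Finite Arc
    noLoops     : ∀ a → tail a ≢ head a
    acyclic     : ∀ n → ¬ TransClosure Edge n n
    arity       : ∀ n → Arity (label n) (Premise n) (Conclusion n)

-- Membership in the subgraph is proof-irrelevant, so that a node of G
-- occurs at most once in it.

induced : (G : Graph) → Pred (Graph.Node G) 0ℓ → Graph
induced G P = record
  { Node  = [ n ∈ Node ∣ P n ]
  ; Arc   = [ a ∈ Arc ∣ (P (tail a) × P (head a)) ]
  ; tail  = λ (a , p) → tail a , Irrelevant.map proj₁ p
  ; head  = λ (a , p) → head a , Irrelevant.map proj₂ p
  ; label = λ n → label (value n)
  }
  where open Graph G

component : (G : Graph) → Graph.Node G → Graph
component G n = induced G (Graph.Linked G n)

record IsThread (G : Graph) : Set where
  open Graph G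
  field
    isLinearLogical : IsLinearLogical G
    connected       : ∀ m n → Linked m n
    oneBot          : ∃! _≡_ λ n → label n ≡ bot
    onePremise      : ∀ n → label n ≢ bot → Premise n HasSize 1

------------------------------------------------------------------------
-- Proof-structures

record ProofStructure : Set₁ where
  field
    graph           : Graph
    isLinearLogical : IsLinearLogical graph

  open Graph graph public
  open IsLinearLogical isLinearLogical public

  field
    parPremises     : ∀ n → label n ≡ ⅋ → Premise n HasSize 2
    premiseOrder    : ∀ n → label n ≡ ⊗ ⊎ label n ≡ ⅋ → TotalOrdering (Premise n)
    conclusionOrder : TotalOrdering (∃ λ a → label (head a) ≡ ●)

  ParNode : Set
  ParNode = ∃ λ n → label n ≡ ⅋

  _≟ᴬ_ : DecidableEquality Arc
  _≟ᴬ_ = inj⇒≟ (↔⇒↣ (proj₂ finiteArcs))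

module _ (R : ProofStructure) where
  open ProofStructure R

  data Erasing : Node → Set where
    erasing : ∀ {n} →
              label n ≡ bot ⊎ label n ≡ ⅋ ⊎ label n ≡ ● →
              (∀ a → head a ≡ n → Erasing (tail a)) →
              Erasing n

  Is¬w⊗ : Set
  Is¬w⊗ = ∀ a → label (head a) ≡ cut ⊎ label (head a) ≡ ⊗ → ¬ Erasing (tail a)

  Switching : Set
  Switching = (n : ParNode) → Premise (proj₁ n)

  WCompatible : Pred Switching 0ℓ
  WCompatible φ = ∀ n (a : Premise (proj₁ n)) →
    ¬ Erasing (tail (proj₁ a)) →
    (∀ (b : Premise (proj₁ n)) → ¬ Erasing (tail (proj₁ b)) → b ≡ a) →
    φ n ≡ a

  -- inj₂ n is the fresh ● node added for the ⅋ node n.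

  redirect : Switching → (a : Arc) → Dec (label (head a) ≡ ⅋) → Node ⊎ ParNode
  redirect φ a (no _)  = inj₁ (head a)
  redirect φ a (yes p) with a ≟ᴬ proj₁ (φ (head a , p))
  ... | yes _ = inj₁ (head a)
  ... | no  _ = inj₂ (head a , p)

  switchingGraph : Switching → Graph
  switchingGraph φ = record
    { Node  = Node ⊎ ParNode
    ; Arc   = Arc
    ; tail  = λ a → inj₁ (tail a)
    ; head  = λ a → redirect φ a (isPar? (label (head a)))
    ; label = [ label , const ● ]′
    }

  -- Every connected component is the component of some node m.

  C∀w : Pred Switching 0ℓ
  C∀w φ = ∀ m →
      (∀ n → Linked′ m (inj₁ n) → ¬ Erasing n)
    ⊎ IsThread (component (switchingGraph φ) m)
    where open Graph (switchingGraph φ) using () renaming (Linked to Linked′)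

{-# OPTIONS --safe #-}

-- For a w-compatible switching of a (¬w⊗)-proof-structure, an arc of the
-- switching graph leaves an erasing node exactly when it enters an erasing
-- node or the fresh ● below one.  So the component of an erasing node is made
-- of such nodes only; each of them has at most one premise and at most one
-- conclusion, and following premises upwards ends in a ⊥ node, the same one
-- throughout the component: the component is a thread.  Conversely, a ⊗ or cut
-- node keeps its two premises in every switching graph, so it lies in no
-- thread.

module Submission where

open import Defs
open import Data.Fin.Base using (Fin; zero; suc)
open import Data.Fin.Induction using (spo-wellFounded)
open import Data.Fin.Patterns using (0F; 1F)
open import Data.Fin.Properties using (all?; inj⇒≟; +↔⊎)
open import Data.Irrelevant using (Irrelevant; [_])
open import Data.Nat.Base using (zero; suc; _+_)
open import Data.Product.Base using (Σ; _×_; _,_; proj₁; proj₂; ∃-syntax)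
open import Data.Product.Function.Dependent.Propositional using (Σ-↔)
open import Data.Refinement.Base using (Refinement-syntax; value; _,_)
open import Data.Sum.Base using (_⊎_; inj₁; inj₂; fromInj₁; fromInj₂)
open import Data.Sum.Function.Propositional using (_⊎-↔_)
open import Function.Base using (_∘_; flip; _on_)
open import Function.Bundles using (_⇔_; mk⇔; _↔_; mk↔ₛ′; module Inverse)
open import Function.Properties.Inverse using (↔⇒↣; ↔-refl; ↔-sym; ↔-trans)
open import Induction.WellFounded using (WellFounded; Acc; acc; module Subrelation)
import Relation.Binary.Construct.On as On
open import Relation.Binary.Construct.Closure.ReflexiveTransitive using (Star; ε; _◅_; _◅◅_)
open import Relation.Binary.Construct.Closure.Symmetric using (fwd; bwd)
import Relation.Binary.Construct.Closure.Equivalence as EqClosure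
open import Relation.Binary.Construct.Closure.Transitive using (TransClosure; [_]; _∷_; _++_; wellFounded⁻)
open import Relation.Binary.Definitions using (DecidableEquality)
open import Relation.Binary.PropositionalEquality
  using (_≡_; _≢_; refl; sym; trans; cong; subst; isEquivalence)
open import Relation.Binary.PropositionalEquality.WithK using (≡-irrelevant)
open import Relation.Binary.Structures using (IsStrictPartialOrder)
open import Relation.Nullary.Decidable using (Dec; yes; no; map′; recompute; _×-dec_)
open import Relation.Nullary.Negation using (¬_; contradiction; contradiction-irr)
open import Relation.Unary using (Decidable)

-- Finite sets

private
  variable
    A B : Set

empty⇒size0 : ¬ A → A HasSize 0
empty⇒size0 ¬a = mk↔ₛ′ (λ a → contradiction a ¬a) (λ ()) (λ ()) (λ a → contradiction a ¬a)

size0⇒empty : A HasSize 0 → ¬ A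
size0⇒empty i a with () ← Inverse.to i a

contractible⇒size1 : (x : A) → (∀ y → x ≡ y) → A HasSize 1
contractible⇒size1 x u = mk↔ₛ′ (λ _ → 0F) (λ _ → x) (λ { 0F → refl ; (suc ()) }) u

size1⇒inhabited : A HasSize 1 → A
size1⇒inhabited i = Inverse.from i 0F

size1⇒irrelevant : A HasSize 1 → (x y : A) → x ≡ y
size1⇒irrelevant i x y =
  trans (sym (Inverse.strictlyInverseʳ i x))
        (trans (cong (Inverse.from i) (unique (Inverse.to i x) (Inverse.to i y)))
               (Inverse.strictlyInverseʳ i y))
  where
  unique : (j k : Fin 1) → j ≡ k
  unique 0F 0F = refl

size2⇒pair : A HasSize 2 → ∃[ x ] ∃[ y ] (x ≢ y × ∀ (z : A) → z ≡ x ⊎ z ≡ y)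
size2⇒pair i = from 0F , from 1F , distinct , cover
  where
  open Inverse i
  distinct : from 0F ≢ from 1F
  distinct e with () ← trans (sym (strictlyInverseˡ 0F)) (trans (cong to e) (strictlyInverseˡ 1F))
  cover : ∀ z → z ≡ from 0F ⊎ z ≡ from 1F
  cover z with to z | strictlyInverseʳ z
  ... | 0F | e = inj₁ (sym e)
  ... | 1F | e = inj₂ (sym e)

size2⇒¬size1 : A HasSize 2 → ¬ A HasSize 1
size2⇒¬size1 i j with x , y , x≢y , _ ← size2⇒pair i = x≢y (size1⇒irrelevant j x y)

size2⇒other : A HasSize 2 → (x : A) → ∃[ y ] (y ≢ x × ∀ z → z ≢ x → z ≡ y)
size2⇒other i x with p , q , p≢q , cover ← size2⇒pair i | cover x
... | inj₁ refl = q , p≢q ∘ sym , λ z z≢p → fromInj₂ (λ e → contradiction e z≢p) (cover z)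
... | inj₂ refl = p , p≢q , λ z z≢q → fromInj₁ (λ e → contradiction e z≢q) (cover z)

finite-≟ : Finite A → DecidableEquality A
finite-≟ (_ , i) = inj⇒≟ (↔⇒↣ i)

finite-all? : {P : A → Set} → Finite A → Decidable P → Dec (∀ a → P a)
finite-all? {P = P} (_ , i) P? =
  map′ (λ f a → subst P (strictlyInverseʳ a) (f (to a))) (λ f j → f (from j)) (all? (P? ∘ from))
  where open Inverse i

finite-↔ : A ↔ B → Finite B → Finite A
finite-↔ i (k , j) = k , ↔-trans i j

finite-⊎ : Finite A → Finite B → Finite (A ⊎ B)
finite-⊎ (k , i) (l , j) = k + l , ↔-trans (i ⊎-↔ j) (↔-sym +↔⊎)

finite-dec : Dec A → (∀ (x y : A) → x ≡ y) → Finite A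
finite-dec (yes a) u = 1 , contractible⇒size1 a (u a)
finite-dec (no ¬a) u = 0 , empty⇒size0 ¬a

Σ-Fin-suc : ∀ {k} {B : Fin (suc k) → Set} → Σ (Fin (suc k)) B ↔ (B zero ⊎ Σ (Fin k) (B ∘ suc))
Σ-Fin-suc = mk↔ₛ′
  (λ { (zero , b) → inj₁ b ; (suc i , b) → inj₂ (i , b) })
  (λ { (inj₁ b) → zero , b ; (inj₂ (i , b)) → suc i , b })
  (λ { (inj₁ b) → refl ; (inj₂ (i , b)) → refl })
  (λ { (zero , b) → refl ; (suc i , b) → refl })

finite-Σ-Fin : ∀ k {B : Fin k → Set} → (∀ i → Finite (B i)) → Finite (Σ (Fin k) B)
finite-Σ-Fin zero    f = 0 , empty⇒size0 λ ()
finite-Σ-Fin (suc k) f = finite-↔ Σ-Fin-suc (finite-⊎ (f zero) (finite-Σ-Fin k (f ∘ suc)))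

finite-Σ : {B : A → Set} → Finite A → (∀ a → Finite (B a)) → Finite (Σ A B)
finite-Σ (k , i) f =
  finite-↔ (↔-sym (Σ-↔ (↔-sym i) ↔-refl)) (finite-Σ-Fin k (f ∘ Inverse.from i))

-- Membership is stored irrelevantly, so over each `a` it has at most one proof; deciding `P a`
-- makes that fibre of size 0 or 1.
finite-refinement : {P : A → Set} → Finite A → Decidable P → Finite [ a ∈ A ∣ P a ]
finite-refinement {P = P} fin P? =
  finite-↔ (mk↔ₛ′ (λ (a , p) → a , p) (λ (a , p) → a , p) (λ _ → refl) (λ _ → refl))
    (finite-Σ fin λ a → finite-dec (irrelevant? (P? a)) (λ _ _ → refl))
  where
  irrelevant? : ∀ {a} → Dec (P a) → Dec (Irrelevant (P a))
  irrelevant? (yes p) = yes [ p ]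
  irrelevant? (no ¬p) = no λ { [ p ] → contradiction-irr p ¬p }

-- Acyclicity makes the transitive closure, transported to `Fin k`, a strict partial order, and
-- these are well founded on `Fin k`. Applied to `Edge`, it justifies recursion from a node to the
-- tails of its premises.
finite-acyclic⇒wellFounded : {_∼_ : A → A → Set} → Finite A →
                             (∀ x → ¬ TransClosure _∼_ x x) → WellFounded _∼_
finite-acyclic⇒wellFounded {A = A} {_∼_} (k , i) acyclic =
  wellFounded⁻ _∼_ (Subrelation.wellFounded {_<₁_ = TransClosure _∼_} {_<₂_ = _<_ on to} into
    (On.wellFounded to (spo-wellFounded isSPO)))
  where
  open Inverse i
  _<_ : Fin k → Fin k → Set
  _<_ = TransClosure _∼_ on from
  into : ∀ {x y} → TransClosure _∼_ x y → to x < to y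
  into {x} {y} p rewrite strictlyInverseʳ x | strictlyInverseʳ y = p
  isSPO : IsStrictPartialOrder _≡_ _<_
  isSPO = record
    { isEquivalence = isEquivalence
    ; irrefl        = λ { {j} refl p → acyclic (from j) p }
    ; trans         = _++_
    ; <-resp-≈      = (λ { refl p → p }) , (λ { refl p → p })
    }

-- Components of graphs

Arity-↔ : ∀ l {P P′ C C′ : Set} → P′ ↔ P → C′ ↔ C → Arity l P C → Arity l P′ C′
Arity-↔ ax  i j (p , c)      = ↔-trans i p , ↔-trans j c
Arity-↔ cut i j (p , c)      = ↔-trans i p , ↔-trans j c
Arity-↔ 𝟙   i j (p , c)      = ↔-trans i p , ↔-trans j c
Arity-↔ bot i j (p , c)      = ↔-trans i p , ↔-trans j c
Arity-↔ ⊗   i j (p , c)      = ↔-trans i p , ↔-trans j c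
Arity-↔ ⅋   i j (inj₁ p , c) = inj₁ (↔-trans i p) , ↔-trans j c
Arity-↔ ⅋   i j (inj₂ p , c) = inj₂ (↔-trans i p) , ↔-trans j c
Arity-↔ ●   i j (p , c)      = ↔-trans i p , ↔-trans j c

module Component (G : Graph) (m : Graph.Node G) where
  open Graph G
  private module C = Graph (component G m)

  linked-head : ∀ {a} → Linked m (tail a) → Linked m (head a)
  linked-head {a} l = l ◅◅ (fwd (a , refl , refl) ◅ ε)

  linked-tail : ∀ {a} → Linked m (head a) → Linked m (tail a)
  linked-tail {a} l = l ◅◅ (bwd (a , refl , refl) ◅ ε)

  -- A component contains both ends of every arc it touches, so its nodes keep all their premises;
  -- this is how they inherit arities.
  premise↔ : ∀ x → C.Premise x ↔ Premise (value x)
  premise↔ (x , [ p ]) = mk↔ₛ′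
    (λ (a , e) → value a , cong value e)
    (λ { (a , refl) → (a , [ linked-tail p , p ]) , refl })
    (λ { (a , refl) → refl })
    (λ { (a , refl) → refl })

  conclusion↔ : ∀ x → C.Conclusion x ↔ Conclusion (value x)
  conclusion↔ (x , [ p ]) = mk↔ₛ′
    (λ (a , e) → value a , cong value e)
    (λ { (a , refl) → (a , [ p , linked-head p ]) , refl })
    (λ { (a , refl) → refl })
    (λ { (a , refl) → refl })

  -- Every node along the path is itself linked to `m`, so the whole path lives in the component.
  linked-lift : ∀ {x y} → Linked x y → .(p : Linked m x) → .(q : Linked m y) →
                C.Linked (x , [ p ]) (y , [ q ])
  linked-lift ε p q = ε
  linked-lift (fwd (a , refl , refl) ◅ l) p q =
    fwd ((a , [ p , linked-head p ]) , refl , refl) ◅ linked-lift l (linked-head p) q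
  linked-lift (bwd (a , refl , refl) ◅ l) p q =
    bwd ((a , [ linked-tail p , p ]) , refl , refl) ◅ linked-lift l (linked-tail p) q

  acyclic-component : (∀ x → ¬ TransClosure Edge x x) → ∀ x → ¬ TransClosure C.Edge x x
  acyclic-component acyclic x p = acyclic (value x) (lower p)
    where
    edge : ∀ {x y} → C.Edge x y → Edge (value x) (value y)
    edge (a , refl , refl) = value a , refl , refl
    lower : ∀ {x y} → TransClosure C.Edge x y → TransClosure Edge (value x) (value y)
    lower [ e ]    = [ edge e ]
    lower (e ∷ es) = edge e ∷ lower es

-- Threads

-- The possible local shapes of a node in an erasing component of a switching graph. A `⅋` node has
-- one premise there, the other having moved to a fresh `●` node.
data Strand (P C : Set) : Label → Set where
  source : P HasSize 0 → C HasSize 1 → Strand P C bot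
  middle : P HasSize 1 → C HasSize 1 → Strand P C ⅋
  sink   : P HasSize 1 → C HasSize 0 → Strand P C ●

strand-arity : ∀ {P C l} → Strand P C l → Arity l P C
strand-arity (source p c) = p , c
strand-arity (middle p c) = inj₁ p , c
strand-arity (sink p c)   = p , c

strand-bot : ∀ {P C l} → Strand P C l → l ≡ bot → ¬ P
strand-bot (source p _) refl = size0⇒empty p

strand-¬bot : ∀ {P C l} → Strand P C l → l ≢ bot → P HasSize 1
strand-¬bot (source _ _) l≢bot = contradiction refl l≢bot
strand-¬bot (middle p _) _     = p
strand-¬bot (sink p _)   _     = p

strand-unique : ∀ {P C l} → Strand P C l → (x y : P) → x ≡ y
strand-unique (source p _) x y = contradiction x (size0⇒empty p)
strand-unique (middle p _)     = size1⇒irrelevant p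
strand-unique (sink p _)       = size1⇒irrelevant p

-- `E` is a union of components, being closed along arcs both ways. It abstracts the erasing nodes
-- together with the fresh nodes below them.
module Threads
  (G : Graph)
  (finiteNodes : Finite (Graph.Node G)) (finiteArcs : Finite (Graph.Arc G))
  (acyclic : ∀ x → ¬ TransClosure (Graph.Edge G) x x)
  (E : Graph.Node G → Set) (E? : Decidable E)
  (E-head : ∀ a → E (Graph.tail G a) → E (Graph.head G a))
  (E-tail : ∀ a → E (Graph.head G a) → E (Graph.tail G a))
  (strand : ∀ {x} → E x → Strand (Graph.Premise G x) (Graph.Conclusion G x) (Graph.label G x))
  where
  open Graph G

  E-linked : ∀ {x y} → Linked x y → E x → E y
  E-linked ε e = e
  E-linked (fwd (a , refl , refl) ◅ l) e = E-linked l (E-head a e)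
  E-linked (bwd (a , refl , refl) ◅ l) e = E-linked l (E-tail a e)

  Ascent : Node → Node → Set
  Ascent = Star (flip Edge)

  -- A node of `E` that is not `bot` has a premise, whose tail is again in `E`; climbing stops by
  -- well-foundedness.
  root : ∀ {x} → E x → ∃[ b ] (Ascent x b × label b ≡ bot)
  root = go (finite-acyclic⇒wellFounded finiteNodes acyclic _)
    where
    go : ∀ {x} → Acc Edge x → E x → ∃[ b ] (Ascent x b × label b ≡ bot)
    ascend : ∀ {x} → Acc Edge x → E x → Premise x → ∃[ b ] (Ascent x b × label b ≡ bot)
    ascend (acc rec) e (a , refl) with b , s , l ← go (rec (a , refl , refl)) (E-tail a e) =
      b , (a , refl , refl) ◅ s , l
    go {x} r e with label x in eq | strand e
    ... | bot | source _ _ = x , ε , eq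
    ... | ⅋   | middle p _ = ascend r e (size1⇒inhabited p)
    ... | ●   | sink p _   = ascend r e (size1⇒inhabited p)

  -- Ascents are deterministic: a `bot` node has no premise, and any other node of `E` has only one.
  root-unique : ∀ {x b c} → E x → Ascent x b → label b ≡ bot → Ascent x c → label c ≡ bot → b ≡ c
  root-unique e ε l ε l′ = refl
  root-unique e ε l ((a , _ , h) ◅ _) l′ = contradiction (a , h) (strand-bot (strand e) l)
  root-unique e ((a , _ , h) ◅ _) l ε l′ = contradiction (a , h) (strand-bot (strand e) l′)
  root-unique e ((a , refl , refl) ◅ s) l ((a′ , refl , h) ◅ s′) l′
    with refl ← strand-unique (strand e) (a , refl) (a′ , h) = root-unique (E-tail a e) s l s′ l′

  -- The root is constant along links. Moving down an arc prolongs the ascent by that arc; moving up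
  -- an arc removes it, since the ascent had to begin with the unique premise.
  ascent-linked : ∀ {x y b} → E x → Linked x y → label b ≡ bot → Ascent x b → Ascent y b
  ascent-linked e ε lb s = s
  ascent-linked e (fwd (a , refl , refl) ◅ l) lb s =
    ascent-linked (E-head a e) l lb ((a , refl , refl) ◅ s)
  ascent-linked e (bwd (a , refl , refl) ◅ l) lb ε =
    contradiction (a , refl) (strand-bot (strand e) lb)
  ascent-linked e (bwd (a , refl , refl) ◅ l) lb ((a′ , refl , h) ◅ s)
    with refl ← strand-unique (strand e) (a , refl) (a′ , h) = ascent-linked (E-tail a e) l lb s

  ascent⇒linked : ∀ {x b} → Ascent x b → Linked x b
  ascent⇒linked ε       = ε
  ascent⇒linked (e ◅ s) = bwd e ◅ ascent⇒linked s

  linked-sym : ∀ {x y} → Linked x y → Linked y x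
  linked-sym = EqClosure.symmetric Edge

  -- Two nodes of E are linked exactly when their roots coincide.
  linked? : ∀ {m} → E m → Decidable (Linked m)
  linked? {m} e x with E? x
  ... | no ¬ex = no λ l → ¬ex (E-linked l e)
  ... | yes ex with root e | root ex
  ...   | b , r , lb | c , s , lc with finite-≟ finiteNodes b c
  ...     | yes refl = yes (ascent⇒linked r ◅◅ linked-sym (ascent⇒linked s))
  ...     | no b≢c   = no λ l → b≢c (root-unique ex (ascent-linked e l lb r) lb s lc)

  -- Deciding `Linked m` serves twice: it makes the component finite, and `recompute` recovers
  -- usable paths from irrelevant membership proofs.
  component-thread : ∀ {m} → E m → IsThread (component G m)
  component-thread {m} e = record
    { isLinearLogical = record
      { finiteNodes = finite-refinement finiteNodes m?
      ; finiteArcs  = finite-refinement finiteArcs λ a → m? (tail a) ×-dec m? (head a)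
      ; noLoops     = λ a eq → acyclic (tail (value a)) [ value a , refl , sym (cong value eq) ]
      ; acyclic     = acyclic-component acyclic
      ; arity       = λ x → Arity-↔ (label (value x)) (premise↔ x) (conclusion↔ x)
                              (strand-arity (strand (inE x)))
      }
    ; connected  = λ (x , [ p ]) (y , [ q ]) →
        linked-lift (linked-sym (recompute (m? x) p) ◅◅ recompute (m? y) q) p q
    ; oneBot     = oneBot
    ; onePremise = λ x l → ↔-trans (premise↔ x) (strand-¬bot (strand (inE x)) l)
    }
    where
    open Component G m
    m? = linked? e
    inE : (x : [ x ∈ Node ∣ Linked m x ]) → E (value x)
    inE (x , [ p ]) = E-linked (recompute (m? x) p) e
    oneBot : ∃[ b ] (label (value b) ≡ bot × ∀ {y} → label (value y) ≡ bot → b ≡ y)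
    oneBot with b , s , l ← root e = (b , [ ascent⇒linked s ]) , l , unique
      where
      unique : ∀ {y} → label (value y) ≡ bot → (b , [ ascent⇒linked s ]) ≡ y
      -- The ascent from `m` to `b` transports to one from `y` to `b`; as `y` is itself `bot`, the
      -- empty ascent competes with it.
      unique {y , [ p ]} l′
        with refl ← root-unique (inE (y , [ p ]))
                       (ascent-linked e (recompute (m? y) p) l s) l ε l′ = refl

-- Erasing nodes and switching graphs

ErasingLabel : Label → Set
ErasingLabel l = l ≡ bot ⊎ l ≡ ⅋ ⊎ l ≡ ●

erasingLabel? : Decidable ErasingLabel
erasingLabel? ax  = no λ { (inj₁ ()) ; (inj₂ (inj₁ ())) ; (inj₂ (inj₂ ())) }
erasingLabel? cut = no λ { (inj₁ ()) ; (inj₂ (inj₁ ())) ; (inj₂ (inj₂ ())) }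
erasingLabel? 𝟙   = no λ { (inj₁ ()) ; (inj₂ (inj₁ ())) ; (inj₂ (inj₂ ())) }
erasingLabel? bot = yes (inj₁ refl)
erasingLabel? ⊗   = no λ { (inj₁ ()) ; (inj₂ (inj₁ ())) ; (inj₂ (inj₂ ())) }
erasingLabel? ⅋   = yes (inj₂ (inj₁ refl))
erasingLabel? ●   = yes (inj₂ (inj₂ refl))

module _ (R : ProofStructure) where
  open ProofStructure R

  arityAt : ∀ {n l} → label n ≡ l → Arity l (Premise n) (Conclusion n)
  arityAt {n} refl = arity n

  label-≢ : ∀ {n l l′} → label n ≡ l → l ≢ l′ → label n ≢ l′
  label-≢ refl ne = ne

  erasing-premise : ∀ {a} → Erasing R (head a) → Erasing R (tail a)
  erasing-premise {a} (erasing _ f) = f a refl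

  finitePremises : ∀ n → Finite (Premise n)
  finitePremises n =
    finite-Σ finiteArcs λ a → finite-dec (finite-≟ finiteNodes (head a) n) ≡-irrelevant

  -- The definition of erasing looks only at the label and the finitely many tails above, so
  -- well-founded recursion along `Edge` decides it.
  erasing? : Decidable (Erasing R)
  erasing? n = go (finite-acyclic⇒wellFounded finiteNodes acyclic n)
    where
    go : ∀ {n} → Acc Edge n → Dec (Erasing R n)
    go {n} (acc rec) =
      map′ (λ (l , f) → erasing l λ a e → f (a , e))
           (λ { (erasing l f) → l , λ (a , e) → f a e })
        (erasingLabel? (label n) ×-dec
         finite-all? (finitePremises n) λ (a , e) → go (rec (a , refl , e)))

  -- Selecting the first premise unless its tail is erasing, and the second otherwise, always meets
  -- the constraint.
  wCompatibleSwitching : ∃[ ψ ] WCompatible R ψ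
  wCompatibleSwitching = (λ n → proj₁ (choose n)) , λ n → proj₂ (choose n)
    where
    choose : (n : ParNode) → ∃[ c ] (∀ (a : Premise (proj₁ n)) → ¬ Erasing R (tail (proj₁ a)) →
             (∀ (b : Premise (proj₁ n)) → ¬ Erasing R (tail (proj₁ b)) → b ≡ a) → c ≡ a)
    choose (n , l) with p , q , _ , cover ← size2⇒pair (parPremises n l) with erasing? (tail (proj₁ p))
    -- If `a` is the only premise with non-erasing tail, then it is `p`.
    ... | no ¬ep = p , λ a _ only → only p ¬ep
    -- A premise with non-erasing tail can then only be `q`.
    ... | yes ep = q , pick
      where
      pick : ∀ a → ¬ Erasing R (tail (proj₁ a)) → _ → q ≡ a
      pick a ¬ea _ with cover a
      ... | inj₁ refl = contradiction ep ¬ea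
      ... | inj₂ refl = refl

  -- Premises, acyclicity and finiteness of a switching graph

  module _ (φ : Switching R) where
    private
      Rφ = switchingGraph R φ
      module S = Graph Rφ

    -- A view of `S.head a`: abstracting both at once replaces the two decisions nested in
    -- `redirect` by three cases.
    data Redirected (a : Arc) : S.Node → Set where
      kept       : label (head a) ≢ ⅋ → Redirected a (inj₁ (head a))
      selected   : ∀ p → a ≡ proj₁ (φ (head a , p)) → Redirected a (inj₁ (head a))
      unselected : ∀ p → a ≢ proj₁ (φ (head a , p)) → Redirected a (inj₂ (head a , p))

    redirected′ : ∀ a d → Redirected a (redirect R φ a d)
    redirected′ a (no ¬p) = kept ¬p
    redirected′ a (yes p) with a ≟ᴬ proj₁ (φ (head a , p))
    ... | yes e = selected p e
    ... | no ¬e = unselected p ¬e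

    redirected : ∀ a → Redirected a (S.head a)
    redirected a = redirected′ a (isPar? (label (head a)))

    head-¬par : ∀ a → label (head a) ≢ ⅋ → S.head a ≡ inj₁ (head a)
    head-¬par a ¬p with S.head a | redirected a
    ... | _ | kept _         = refl
    ... | _ | selected _ _   = refl
    ... | _ | unselected p _ = contradiction p ¬p

    head-selected : ∀ a p → a ≡ proj₁ (φ (head a , p)) → S.head a ≡ inj₁ (head a)
    head-selected a p e with S.head a | redirected a
    ... | _ | kept _          = refl
    ... | _ | selected _ _    = refl
    -- A `ParNode` carries a proof about its label; uniqueness of identity proofs identifies the
    -- node in the view with the given one.
    ... | _ | unselected p′ ¬e with refl ← ≡-irrelevant p p′ = contradiction e ¬e

    head-unselected : ∀ a p → a ≢ proj₁ (φ (head a , p)) → S.head a ≡ inj₂ (head a , p)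
    head-unselected a p ¬e with S.head a | redirected a
    ... | _ | kept ¬p         = contradiction p ¬p
    ... | _ | selected p′ e   with refl ← ≡-irrelevant p p′ = contradiction e ¬e
    ... | _ | unselected p′ _ with refl ← ≡-irrelevant p p′ = refl

    -- Quantifying over `p` covers all nodes uniformly: the second component is vacuous unless `n`
    -- is a `⅋` node.
    head-inj₁ : ∀ {a n} → S.head a ≡ inj₁ n → head a ≡ n × ∀ p → a ≡ proj₁ (φ (n , p))
    head-inj₁ {a} e with S.head a | redirected a
    head-inj₁ refl | _ | kept ¬p       = refl , λ p → contradiction p ¬p
    head-inj₁ refl | _ | selected p′ e =
      refl , λ p → subst (λ p → _ ≡ proj₁ (φ (_ , p))) (≡-irrelevant p′ p) e

    head-inj₂ : ∀ {a n} → S.head a ≡ inj₂ n → head a ≡ proj₁ n × a ≢ proj₁ (φ n)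
    head-inj₂ {a} e with S.head a | redirected a
    head-inj₂ refl | _ | unselected p ¬e = refl , ¬e

    Premise-≡ : ∀ {n} {a b : Premise n} → proj₁ a ≡ proj₁ b → a ≡ b
    Premise-≡ {a = a , e} {_ , e′} refl = cong (a ,_) (≡-irrelevant e e′)

    switchedPremise-≡ : ∀ {x} {a b : S.Premise x} → proj₁ a ≡ proj₁ b → a ≡ b
    switchedPremise-≡ {a = a , e} {_ , e′} refl = cong (a ,_) (≡-irrelevant e e′)

    other : (n : ParNode) → ∃[ b ] (b ≢ φ n × ∀ c → c ≢ φ n → c ≡ b)
    other n = size2⇒other (parPremises (proj₁ n) (proj₂ n)) (φ n)

    premise-¬par : ∀ {n} → label n ≢ ⅋ → S.Premise (inj₁ n) ↔ Premise n
    premise-¬par ¬p = mk↔ₛ′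
      (λ (a , e) → a , proj₁ (head-inj₁ e))
      (λ (a , e) → a , trans (head-¬par a (¬p ∘ trans (cong label (sym e)))) (cong inj₁ e))
      (λ _ → Premise-≡ refl)
      (λ _ → switchedPremise-≡ refl)

    premise-par : ∀ n → S.Premise (inj₁ (proj₁ n)) HasSize 1
    premise-par (n , p) = contractible⇒size1 (proj₁ (φ (n , p)) , stays (φ (n , p)) refl)
      λ (a , e) → switchedPremise-≡ (sym (proj₂ (head-inj₁ e) p))
      where
      stays : ∀ b → b ≡ φ (n , p) → S.head (proj₁ b) ≡ inj₁ n
      stays (a , refl) e = head-selected a p (cong proj₁ e)

    premise-fresh : ∀ n → S.Premise (inj₂ n) HasSize 1
    premise-fresh (n , p) with other (n , p)
    ... | (b , refl) , b≢ , only = contractible⇒size1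
      (b , head-unselected b p (b≢ ∘ Premise-≡))
      λ (a , e) → let h , a≢ = head-inj₂ e in
        switchedPremise-≡ (sym (cong proj₁ (only (a , h) (a≢ ∘ cong proj₁))))

    conclusion↔ : ∀ n → S.Conclusion (inj₁ n) ↔ Conclusion n
    conclusion↔ n = mk↔ₛ′
      (λ { (a , refl) → a , refl })
      (λ { (a , refl) → a , refl })
      (λ { (a , refl) → refl })
      (λ { (a , refl) → refl })

    -- Fresh nodes are tails of no arc, so a path meets one at most at its end. A path ending at an
    -- original node is therefore a path of `R`, and a cycle would be one of `R`.
    switched-edge⁺ : ∀ {x y} → TransClosure S.Edge x y →
      ∃[ m ] (x ≡ inj₁ m × ∀ {n} → y ≡ inj₁ n → TransClosure Edge m n)
    switched-edge⁺ [ a , refl , e ] =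
      tail a , refl , λ { refl → [ a , refl , proj₁ (head-inj₁ e) ] }
    switched-edge⁺ ((a , refl , e) ∷ p) with m , refl , f ← switched-edge⁺ p =
      tail a , refl , λ y≡n → (a , refl , proj₁ (head-inj₁ e)) ∷ f y≡n

    switched-acyclic : ∀ x → ¬ TransClosure S.Edge x x
    switched-acyclic x p with m , refl , f ← switched-edge⁺ p = acyclic m (f refl)

    switched-finiteNodes : Finite S.Node
    switched-finiteNodes = finite-⊎ finiteNodes finiteParNodes
      where
      finiteParNodes : Finite ParNode
      finiteParNodes = finite-Σ finiteNodes λ n → finite-dec (isPar? (label n)) ≡-irrelevant

    -- Erasing nodes along the arcs of a switching graph

    -- The arc entering the fresh node of `n` is the premise `other n`, so a fresh node is
    -- classified by the tail of that arc.
    ErasingOrFresh : S.Node → Set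
    ErasingOrFresh (inj₁ n) = Erasing R n
    ErasingOrFresh (inj₂ n) = Erasing R (tail (proj₁ (proj₁ (other n))))

    erasingOrFresh? : Decidable ErasingOrFresh
    erasingOrFresh? (inj₁ n) = erasing? n
    erasingOrFresh? (inj₂ n) = erasing? _

    other-unselected : ∀ a p → a ≢ proj₁ (φ (head a , p)) → proj₁ (proj₁ (other (head a , p))) ≡ a
    other-unselected a p ¬e =
      sym (cong proj₁ (proj₂ (proj₂ (other (head a , p))) (a , refl) (¬e ∘ cong proj₁)))

    ErasingOrFresh-tail : ∀ a → ErasingOrFresh (S.head a) → Erasing R (tail a)
    ErasingOrFresh-tail a e with S.head a | redirected a
    ... | _ | kept _          = erasing-premise e
    ... | _ | selected _ _    = erasing-premise e
    ... | _ | unselected p ¬e = subst (Erasing R ∘ tail) (other-unselected a p ¬e) e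

    -- A head outside `⅋` must be `●`, since `Is¬w⊗` excludes `cut` and `⊗` and the remaining labels
    -- have no premise. At a `⅋` node reached by its selected premise, compatibility forces the
    -- other premise to be erasing too.
    ErasingOrFresh-head : Is¬w⊗ R → WCompatible R φ →
                          ∀ a → Erasing R (tail a) → ErasingOrFresh (S.head a)
    ErasingOrFresh-head ¬w⊗ compat a e with S.head a | redirected a
    ... | _ | unselected p ¬e = subst (Erasing R ∘ tail) (sym (other-unselected a p ¬e)) e
    ... | _ | selected p a≡φ  = erasing (inj₂ (inj₁ p)) siblings
      where
      siblings : ∀ b → head b ≡ head a → Erasing R (tail b)
      siblings b h with erasing? (tail b)
      ... | yes eb = eb
      ... | no ¬eb = contradiction (subst (Erasing R ∘ tail) a≡b e) ¬eb
        where
        ≢a : ∀ {c : Premise (head a)} → ¬ Erasing R (tail (proj₁ c)) → c ≢ (a , refl)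
        ≢a ¬ec refl = ¬ec e
        -- Both `b` and any premise `c` with non-erasing tail differ from `a`, hence coincide. So
        -- `b` is the only such premise and compatibility selects it, whereas `a` is the selected
        -- one.
        a≡b : a ≡ b
        a≡b with _ , _ , only ← size2⇒other (parPremises _ p) (a , refl) =
          trans a≡φ (cong proj₁ (compat (head a , p) (b , h) ¬eb λ c ¬ec →
            trans (only c (≢a ¬ec)) (sym (only (b , h) (≢a ¬eb)))))
    ... | _ | kept ¬p with label (head a) in eq | arity (head a)
    ...   | ax  | p , _ = contradiction (a , refl) (size0⇒empty p)
    ...   | cut | _     = contradiction e (¬w⊗ a (inj₁ eq))
    ...   | 𝟙   | p , _ = contradiction (a , refl) (size0⇒empty p)
    ...   | bot | p , _ = contradiction (a , refl) (size0⇒empty p)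
    ...   | ⊗   | _     = contradiction e (¬w⊗ a (inj₂ eq))
    ...   | ⅋   | _     = contradiction refl ¬p
    -- The single premise of a `●` node is `a`, whose tail is erasing.
    ...   | ●   | p , _ = erasing (inj₂ (inj₂ eq)) λ b h →
      subst (Erasing R ∘ tail) (cong proj₁ (size1⇒irrelevant p (a , refl) (b , h))) e

    erasing-strand : ∀ {x} → ErasingOrFresh x → Strand (S.Premise x) (S.Conclusion x) (S.label x)
    erasing-strand {inj₂ n} _ = sink (premise-fresh n) (empty⇒size0 λ ())
    erasing-strand {inj₁ n} (erasing (inj₁ l) _) =
      let p , c = arityAt l in
      subst (Strand _ _) (sym l)
        (source (↔-trans (premise-¬par (label-≢ l λ ())) p) (↔-trans (conclusion↔ n) c))
    erasing-strand {inj₁ n} (erasing (inj₂ (inj₁ l)) _) =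
      subst (Strand _ _) (sym l)
        (middle (premise-par (n , l)) (↔-trans (conclusion↔ n) (proj₂ (arityAt l))))
    erasing-strand {inj₁ n} (erasing (inj₂ (inj₂ l)) _) =
      let p , c = arityAt l in
      subst (Strand _ _) (sym l)
        (sink (↔-trans (premise-¬par (label-≢ l λ ())) p) (↔-trans (conclusion↔ n) c))

    -- Equivalence of the three conditions

    -- `ErasingOrFresh` is constant on each component, so testing the single node `m` settles the
    -- alternative.
    ¬w⊗⇒C∀w : Is¬w⊗ R → WCompatible R φ → C∀w R φ
    ¬w⊗⇒C∀w ¬w⊗ compat = dichotomy
      where
      open Threads Rφ
        switched-finiteNodes finiteArcs switched-acyclic ErasingOrFresh erasingOrFresh?
        (ErasingOrFresh-head ¬w⊗ compat) ErasingOrFresh-tail erasing-strand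
      dichotomy : C∀w R φ
      dichotomy m with erasingOrFresh? m
      ... | yes e = inj₂ (component-thread e)
      ... | no ¬e = inj₁ λ n l e → ¬e (E-linked (linked-sym l) e)

    -- The component of an erasing `tail a` must be a thread, yet it would also contain the `cut` or
    -- `⊗` node `head a`.
    C∀w⇒¬w⊗ : C∀w R φ → Is¬w⊗ R
    C∀w⇒¬w⊗ c a l e with c (inj₁ (tail a))
    ... | inj₁ none   = none (tail a) ε e
    ... | inj₂ thread = impossible l
      where
      open IsThread thread using (onePremise)
      module C = Graph (component Rφ (inj₁ (tail a)))
      ¬par : label (head a) ≡ cut ⊎ label (head a) ≡ ⊗ → label (head a) ≢ ⅋
      ¬par (inj₁ l) = label-≢ l λ ()
      ¬par (inj₂ l) = label-≢ l λ ()
      x : C.Node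
      x = inj₁ (head a) , [ fwd (a , refl , head-¬par a (¬par l)) ◅ ε ]
      -- A thread is itself linear logical, so the arity of `x` inside the component gives two
      -- premises, against `onePremise`.
      arityX : ∀ {l} → label (head a) ≡ l → Arity l (C.Premise x) (C.Conclusion x)
      arityX refl = IsLinearLogical.arity (IsThread.isLinearLogical thread) x
      impossible : ¬ (label (head a) ≡ cut ⊎ label (head a) ≡ ⊗)
      impossible (inj₁ l) =
        size2⇒¬size1 (proj₁ (arityX l)) (onePremise x (label-≢ l λ ()))
      impossible (inj₂ l) =
        size2⇒¬size1 (proj₁ (arityX l)) (onePremise x (label-≢ l λ ()))

lemma45 : (R : ProofStructure) →
    (Is¬w⊗ R ⇔ (∀ ψ → WCompatible R ψ → C∀w R ψ))
    × ((∀ ψ → WCompatible R ψ → C∀w R ψ) ⇔ (∃[ ψ ] (WCompatible R ψ × C∀w R ψ)))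
lemma45 R =
    mk⇔ (λ ¬w⊗ ψ → ¬w⊗⇒C∀w R ψ ¬w⊗)
        (λ all → C∀w⇒¬w⊗ R ψ₀ (all ψ₀ compat₀))
  , mk⇔ (λ all → ψ₀ , compat₀ , all ψ₀ compat₀)
        -- The passage from one switching to all goes through `Is¬w⊗ R`, which does not mention
        -- switchings.
        (λ (ψ , _ , c) ψ′ → ¬w⊗⇒C∀w R ψ′ (C∀w⇒¬w⊗ R ψ c))
  where
  -- A compatible switching always exists, so the universal condition is never vacuous.
  ψ₀ = proj₁ (wCompatibleSwitching R)
  compat₀ = proj₂ (wCompatibleSwitching R)
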